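{- Let $\models$ be an intersective mixed consequence truth-relation on a finite set $V$ of truth values, with induced consequence relation $\vdash$ in a constant expressive setting. The following are equivalent: (i) $\vdash$ admits a G-disjunction; (ii) every minimal representation of $\models$ is based on a disjunction-compatible list of sets of designated values; (iii) some representation of $\models$ is based on a disjunction-compatible list of sets of designated values.
   Context: $V$ contains distinct $1,0$; sets of designated values: $\mathcal{D}\subseteq V$, $1\in\mathcal{D}$, $0\notin\mathcal{D}$. $\gamma\models_{\mathcal{D}_p,\mathcal{D}_c}\delta$ iff ($\gamma\subseteq\mathcal{D}_p\Rightarrow\delta\cap\mathcal{D}_c\neq\emptyset$). An intersective mixed truth-relation is $\models_{\mathcal{D}_p^1,\mathcal{D}_c^1}\cap\dots\cap\models_{\mathcal{D}_p^K,\mathcal{D}_c^K}$; such a list is a representation, based on the list of sets $\mathcal{D}_p^1,\mathcal{D}_c^1,\dots,\mathcal{D}_p^K,\mathcal{D}_c^K$; it is minimal if $K$ is least possible. A list $\mathcal{D}_1,\dots,\mathcal{D}_n$ is disjunction-compatible if for all $x,y\in V$ there is $z\in V$ such that for every $i$: $z\in\mathcal{D}_i$ iff ($x\in\mathcal{D}_i$ or $y\in\mathcal{D}_i$). Semantics: valuations mapping atoms to $V$, connectives interpreted by fixed truth functions, extended compositionally, every assignment to finitely many distinct atoms realized; constant expressive: every value is the constant value of some formula. $\Gamma\vdash\Delta$ iff $v(\Gamma)\models v(\Delta)$ for all $v$. A G-disjunction is a binary connective $\vee$ (interpreted by some truth function) with, for all $\Gamma,\Delta,A,B$: $\Gamma\vdash\{A\vee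 B\}\cup\Delta$ iff $\Gamma\vdash\{A,B\}\cup\Delta$; and $\Gamma\cup\{A\vee B\}\vdash\Delta$ iff ($\Gamma\cup\{A\}\vdash\Delta$ and $\Gamma\cup\{B\}\vdash\Delta$). -}

module Defs where

open import Level using (0ℓ)
open import Data.Fin using (Fin)
open import Data.Fin.Subset using (Subset; _∈_; _∉_)
open import Data.List using (List; []; _∷_; concatMap)
open import Data.List.NonEmpty using (List⁺; toList; length)
open import Data.List.Relation.Unary.All using (All)
open import Data.Maybe using (Maybe; just; nothing)
open import Data.Nat using (ℕ; _≤_)
open import Data.Product using (∃; ∃-syntax; _×_; _,_)
open import Data.Sum using (_⊎_)
open import Data.Vec using (Vec; []; _∷_)
open import Function.Bundles using (_⇔_)
open import Function.Definitions using (Injective)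
open import Relation.Binary.Core using (Rel)
open import Relation.Binary.PropositionalEquality using (_≡_; _≢_)
open import Relation.Unary using (Pred; Satisfiable; ｛_｝; _∪_; _∩_; _⊆_)

record TruthValues : Set where
  field
    size : ℕ
    𝟙 𝟘  : Fin size
    𝟙≢𝟘  : 𝟙 ≢ 𝟘

  V : Set
  V = Fin size

-- Sets of designated values are decidable (Subset), whereas a truth-relation
-- relates arbitrary predicates on V: the image v(Γ) of a set of formulas Γ
-- under a valuation need not be decidable.

module _ (T : TruthValues) where
  open TruthValues T

  TruthRelation : Set₁
  TruthRelation = Rel (Pred V 0ℓ) 0ℓ

  record Designated : Set where
    field
      set : Subset size
      𝟙∈  : 𝟙 ∈ set
      𝟘∉  : 𝟘 ∉ set

  open Designated

  record Standards : Set where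
    field
      premise conclusion : Designated

  open Standards

  Mixed : Standards → TruthRelation
  Mixed s γ δ =
    γ ⊆ (_∈ set (premise s)) → Satisfiable (δ ∩ (_∈ set (conclusion s)))

  IntersectionOf : List⁺ Standards → TruthRelation
  IntersectionOf ss γ δ = All (λ s → Mixed s γ δ) (toList ss)

  Represents : List⁺ Standards → TruthRelation → Set₁
  Represents ss _⊨_ = ∀ γ δ → (γ ⊨ δ) ⇔ IntersectionOf ss γ δ

  IntersectiveMixed : TruthRelation → Set₁
  IntersectiveMixed ⊨ = ∃[ ss ] Represents ss ⊨

  MinimalRepresentation : List⁺ Standards → TruthRelation → Set₁
  MinimalRepresentation ss ⊨ =
    Represents ss ⊨ × (∀ ss′ → Represents ss′ ⊨ → length ss ≤ length ss′)

  basis : List⁺ Standards → List (Subset size)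
  basis ss = concatMap (λ s → set (premise s) ∷ set (conclusion s) ∷ []) (toList ss)

  DisjunctionCompatible : List (Subset size) → Set
  DisjunctionCompatible Ds =
    ∀ (x y : V) → ∃[ z ] All (λ D → z ∈ D ⇔ (x ∈ D ⊎ y ∈ D)) Ds

-- Valuation singles out the admissible valuations among all maps from atoms
-- to V.

record Semantics (V : Set) : Set₁ where
  field
    Atom       : Set
    Connective : Set
    arity      : Connective → ℕ
    ⟦_⟧        : (c : Connective) → Vec V (arity c) → V
    Valuation  : Pred (Atom → V) 0ℓ
    realized   : ∀ {k} (p : Fin k → Atom) → Injective _≡_ _≡_ p →
                 (x : Fin k → V) → ∃[ v ] Valuation v × (∀ i → v (p i) ≡ x i)

  data Formula : Set where
    atom : Atom → Formula
    app  : (c : Connective) → Vec Formula (arity c) → Formula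

  eval  : (Atom → V) → Formula → V
  evals : ∀ {k} → (Atom → V) → Vec Formula k → Vec V k
  eval v (atom a)   = v a
  eval v (app c As) = ⟦ c ⟧ (evals v As)
  evals v []       = []
  evals v (A ∷ As) = eval v A ∷ evals v As

  image : (Atom → V) → Pred Formula 0ℓ → Pred V 0ℓ
  image v Γ x = ∃[ A ] Γ A × eval v A ≡ x

  Consequence : Rel (Pred V 0ℓ) 0ℓ → Rel (Pred Formula 0ℓ) 0ℓ
  Consequence _⊨_ Γ Δ = ∀ v → Valuation v → image v Γ ⊨ image v Δ

  ConstantExpressive : Set
  ConstantExpressive = ∀ x → ∃[ A ] (∀ v → Valuation v → eval v A ≡ x)

-- The language enriched with a new binary connective, interpreted by f;
-- atoms and admissible valuations are unchanged.

module _ {V : Set} (S : Semantics V) (f : V → V → V) where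
  open Semantics S

  enrich : Semantics V
  enrich = record
    { Atom       = Atom
    ; Connective = Maybe Connective
    ; arity      = arity⁺
    ; ⟦_⟧        = ⟦_⟧⁺
    ; Valuation  = Valuation
    ; realized   = realized
    }
    where
    arity⁺ : Maybe Connective → ℕ
    arity⁺ (just c) = arity c
    arity⁺ nothing  = 2

    ⟦_⟧⁺ : (c : Maybe Connective) → Vec V (arity⁺ c) → V
    ⟦ just c ⟧⁺ xs            = ⟦ c ⟧ xs
    ⟦ nothing ⟧⁺ (x ∷ y ∷ []) = f x y

  GDisjunction : Rel (Pred V 0ℓ) 0ℓ → Set₁
  GDisjunction ⊨ = ∀ (Γ Δ : Pred Formula⁺ 0ℓ) (A B : Formula⁺) →
    (Γ ⊢ (｛ A ∨ B ｝ ∪ Δ) ⇔ Γ ⊢ ((｛ A ｝ ∪ ｛ B ｝) ∪ Δ)) ×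
    ((Γ ∪ ｛ A ∨ B ｝) ⊢ Δ ⇔ ((Γ ∪ ｛ A ｝) ⊢ Δ × (Γ ∪ ｛ B ｝) ⊢ Δ))
    where
    Formula⁺ : Set
    Formula⁺ = Semantics.Formula enrich

    infix 4 _⊢_
    _⊢_ : Rel (Pred Formula⁺ 0ℓ) 0ℓ
    _⊢_ = Semantics.Consequence enrich ⊨

    _∨_ : Formula⁺ → Formula⁺ → Formula⁺
    A ∨ B = Semantics.app nothing (A ∷ B ∷ [])

-- To admit a G-disjunction is for some truth function to interpret one when
-- added to the language, with Γ, Δ, A and B ranging over the enriched
-- language; the language itself need not already contain such a connective.

AdmitsGDisjunction : {V : Set} → Semantics V → Rel (Pred V 0ℓ) 0ℓ → Set₁
AdmitsGDisjunction S ⊨ = ∃[ f ] GDisjunction S f ⊨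

{-# OPTIONS --safe #-}

-- For standards s with premise set P s and conclusion set C s, write s ≼ t if
-- P s ⊆ P t and C t ⊆ C s. Then t entails s as a truth-relation,
-- and conversely, if a list of standards entails s, some t in it has s ≼ t. Hence
-- the ≼-maximal standards of ⊨ occur in each of its representations, and a minimal
-- representation consists of maximal standards only. Against a maximal s, the
-- sequents with premises containing P s and conclusions containing ∁ (C s) are
-- decided by s alone, so the G-rules, which constants transfer from ⊢ to ⊨, force
-- f x y to lie in P s, respectively C s, exactly when x or y does. Conversely the
-- values z provided by compatibility define the truth function of a G-disjunction.

module Submission where

open import Defs
open import Data.Product using (∃-syntax; _×_)
open import Function.Bundles using (_⇔_)

open import Level using (0ℓ)
open import Data.Empty using (⊥-elim)
import Data.Fin.Properties as Fin
open import Data.Fin.Subset using (Subset; _∈_; _∉_; _⊆_)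
open import Data.Fin.Subset.Properties using (_∈?_; _⊆?_; ⊆-antisym)
open import Data.List using (List; []; _∷_; filter)
import Data.List as List
open import Data.List.NonEmpty using (List⁺; _∷_; toList; length)
open import Data.List.Properties using (filter-notAll)
open import Data.List.Membership.Propositional using (find; lose) renaming (_∈_ to _∈ₗ_)
open import Data.List.Membership.Propositional.Properties
  using (∈-filter⁺; ∈-concatMap⁺; ∈-concatMap⁻)
open import Data.List.Relation.Binary.Subset.Propositional using () renaming (_⊆_ to _⊆ₗ_)
open import Data.List.Relation.Binary.Subset.Propositional.Properties using (All-resp-⊇)
open import Data.List.Relation.Unary.All using (All)
import Data.List.Relation.Unary.All as All
import Data.List.Relation.Unary.All.Properties as All
open import Data.List.Relation.Unary.Any using (Any; here; there)
import Data.List.Relation.Unary.Any as Any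
open import Data.Maybe using (just; nothing)
open import Data.Nat using (_<_; _≤?_)
open import Data.Nat.Induction using (Acc; acc; <-wellFounded)
open import Data.Nat.Properties using (<⇒≱; ≰⇒>)
open import Data.Product using (_,_; proj₁; proj₂; uncurry; ∃)
open import Data.Sum using (_⊎_; inj₁; inj₂; [_,_]′)
open import Data.Vec using (Vec; []; _∷_)
open import Function using (_∘_; id)
open import Function.Bundles using (mk⇔; Equivalence)
open import Function.Properties.Equivalence using () renaming (sym to ⇔-sym; trans to ⇔-trans)
open import Relation.Binary.Core using (Rel)
open import Relation.Binary.PropositionalEquality using (_≡_; refl; sym; trans; cong; cong₂; subst)
open import Relation.Nullary using (¬_; Dec; yes; no; contradiction)
open import Relation.Nullary.Decidable
  using (map′; decidable-stable; ¬?; _×-dec_; _⊎-dec_; _→-dec_)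
open import Relation.Unary using (Pred; ｛_｝; _∪_; _≐_) renaming (_⊆_ to _⊆ᵤ_)

open Equivalence using (to; from)

infix 3 _⇔-dec_
_⇔-dec_ : {A B : Set} → Dec A → Dec B → Dec (A ⇔ B)
A? ⇔-dec B? =
  map′ (uncurry mk⇔) (λ e → to e , from e) ((A? →-dec B?) ×-dec (B? →-dec A?))

-- Representations and the entailment order on standards.

module Representations (T : TruthValues) where
  open TruthValues T
  open Designated
  open Standards

  premises conclusions : Standards T → Subset size
  premises s    = set (premise s)
  conclusions s = set (conclusion s)

  infix 4 _≼_ _≼?_
  _≼_ : Rel (Standards T) 0ℓ
  s ≼ t = premises s ⊆ premises t × conclusions t ⊆ conclusions s

  _≼?_ : ∀ s t → Dec (s ≼ t)
  s ≼? t = (premises s ⊆? premises t) ×-dec (conclusions t ⊆? conclusions s)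

  ≼-refl : ∀ {s} → s ≼ s
  ≼-refl = id , id

  ≼-trans : ∀ {s t u} → s ≼ t → t ≼ u → s ≼ u
  ≼-trans (p , c) (p′ , c′) = p′ ∘ p , c ∘ c′

  Mixed-≼ : ∀ {s t γ δ} → s ≼ t → Mixed T t γ δ → Mixed T s γ δ
  Mixed-≼ (p , c) m γ⊆ with m (p ∘ γ⊆)
  ... | w , w∈δ , w∈C = w , w∈δ , c w∈C

  Mixed-≐ : ∀ {s γ γ′ δ δ′} → γ ≐ γ′ → δ ≐ δ′ → Mixed T s γ δ → Mixed T s γ′ δ′
  Mixed-≐ (γ⊆ , _) (δ⊆ , _) m γ′⊆ with m (γ′⊆ ∘ γ⊆)
  ... | w , w∈δ , w∈C = w , δ⊆ w∈δ , w∈C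

  -- Finiteness of `V` allows a search for a value in `C t` outside `C s`. If there is one, it lies
  -- in `δ` and satisfies `t`. Otherwise `C t` is included in `C s`, and `γ` being designated by `t`
  -- would give the other half of `s ≼ t`.
  Mixed-⋠ : ∀ {s t γ δ} → (_∈ premises s) ⊆ᵤ γ → (_∉ conclusions s) ⊆ᵤ δ →
            ¬ s ≼ t → Mixed T t γ δ
  Mixed-⋠ {s} {t} P⊆γ ∁C⊆δ s⋠t γ⊆
    with Fin.any? (λ w → (w ∈? conclusions t) ×-dec ¬? (w ∈? conclusions s))
  ... | yes (w , w∈t , w∉s) = w , ∁C⊆δ w∉s , w∈t
  ... | no ∄w = ⊥-elim (s⋠t
    ( (λ x∈P → γ⊆ (P⊆γ x∈P))
    , (λ {w} w∈t → decidable-stable (w ∈? conclusions s) λ w∉s → ∄w (w , w∈t , w∉s))))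

  -- Every standard t with ¬ s ≼ t accepts the sequent with
  -- premises P s and conclusions the complement of C s, which s itself rejects.
  dominated : ∀ {s} ts → (∀ γ δ → IntersectionOf T ts γ δ → Mixed T s γ δ) →
              Any (s ≼_) (toList ts)
  dominated {s} ts ts⇒s with Any.any? (s ≼?_) (toList ts)
  ... | yes s≼ = s≼
  ... | no ∄≼ with ts⇒s (_∈ premises s) (_∉ conclusions s)
                     (All.map (λ {t} → Mixed-⋠ {s} {t} id id) (All.¬Any⇒All¬ _ ∄≼)) id
  ...   | _ , w∉ , w∈ = contradiction w∈ w∉

  -- Maximality is up to mutual `≼`: repetitions are allowed, so a maximal representation need not
  -- be minimal.
  Maximal : List⁺ (Standards T) → Set
  Maximal ss = ∀ {s t} → s ∈ₗ toList ss → t ∈ₗ toList ss → s ≼ t → t ≼ s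

  -- A standard `t` above `s` is also below it by maximality, hence follows from `s`; any other `t`
  -- holds outright by `Mixed-⋠`.
  maximal-mixed : ∀ {ss} → Maximal ss → ∀ {s} → s ∈ₗ toList ss → ∀ {γ δ} →
                  (_∈ premises s) ⊆ᵤ γ → (_∉ conclusions s) ⊆ᵤ δ →
                  Mixed T s γ δ ⇔ IntersectionOf T ss γ δ
  maximal-mixed {ss} max {s} s∈ {γ} {δ} P⊆γ ∁C⊆δ =
    mk⇔ (λ m → All.tabulate (all m)) (λ a → All.lookup a s∈)
    where
    all : Mixed T s γ δ → ∀ {t} → t ∈ₗ toList ss → Mixed T t γ δ
    all m {t} t∈ with s ≼? t
    ... | yes s≼t = Mixed-≼ {t} {s} (max s∈ t∈ s≼t) m
    ... | no  s⋠t = Mixed-⋠ {s} {t} P⊆γ ∁C⊆δ s⋠t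

  sets : Standards T → List (Subset size)
  sets s = premises s ∷ conclusions s ∷ []

  ∈-basis⁻ : ∀ {ss D} → D ∈ₗ basis T ss →
             ∃[ s ] s ∈ₗ toList ss × (D ≡ premises s ⊎ D ≡ conclusions s)
  ∈-basis⁻ {ss} D∈ with find (∈-concatMap⁻ sets {xs = toList ss} D∈)
  ... | s , s∈ , here D≡         = s , s∈ , inj₁ D≡
  ... | s , s∈ , there (here D≡) = s , s∈ , inj₂ D≡

  premises∈basis : ∀ {ss s} → s ∈ₗ toList ss → premises s ∈ₗ basis T ss
  premises∈basis s∈ = ∈-concatMap⁺ sets (lose s∈ (here refl))

  conclusions∈basis : ∀ {ss s} → s ∈ₗ toList ss → conclusions s ∈ₗ basis T ss
  conclusions∈basis s∈ = ∈-concatMap⁺ sets (lose s∈ (there (here refl)))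

  compatible-⊆ : ∀ {Ds Es} → Ds ⊆ₗ Es →
                 DisjunctionCompatible T Es → DisjunctionCompatible T Ds
  compatible-⊆ Ds⊆Es compat x y with compat x y
  ... | z , all = z , All-resp-⊇ Ds⊆Es all

  compatible? : ∀ Ds → Dec (DisjunctionCompatible T Ds)
  compatible? Ds = map′ id id (Fin.all? λ x → Fin.all? λ y → Fin.any? λ z →
    All.all? (λ D → (z ∈? D) ⇔-dec ((x ∈? D) ⊎-dec (y ∈? D))) Ds)

  -- Comparing and shortening representations of one relation.

  module _ {⊨ : TruthRelation T} where

    cofinal : ∀ {ss ts} → Represents T ss ⊨ → Represents T ts ⊨ →
              ∀ {s} → s ∈ₗ toList ss → Any (s ≼_) (toList ts)
    cofinal {ts = ts} rs rt {s} s∈ =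
      dominated {s} ts (λ γ δ m → All.lookup (to (rs γ δ) (from (rt γ δ) m)) s∈)

    -- An arbitrary relation on predicates need not respect extensional equality; a representation
    -- ensures that it does.
    ⊨-≐ : ∀ {ss} → Represents T ss ⊨ → ∀ {γ γ′ δ δ′} → γ ≐ γ′ → δ ≐ δ′ →
          ⊨ γ δ → ⊨ γ′ δ′
    ⊨-≐ rs γ≐ δ≐ = from (rs _ _) ∘ All.map (λ {s} → Mixed-≐ {s} γ≐ δ≐) ∘ to (rs _ _)

    -- Applying `cofinal` in both directions gives `s ≼ t ≼ u` with `u` back in `ss`. Maximality
    -- closes the cycle, so `s` and `t` have the same sets.
    basis-maximal-⊆ : ∀ {ss ts} → Maximal ss → Represents T ss ⊨ → Represents T ts ⊨ →
                      basis T ss ⊆ₗ basis T ts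
    basis-maximal-⊆ {ss} {ts} max rs rt D∈ with ∈-basis⁻ {ss} D∈
    ... | s , s∈ , D≡ with find (cofinal {ss} {ts} rs rt s∈)
    ... | t , t∈ , (p , c) with find (cofinal {ts} {ss} rt rs t∈)
    ... | u , u∈ , (p′ , c′) with max s∈ u∈ (p′ ∘ p , c ∘ c′)
    ... | p″ , c″ with D≡
    ... | inj₁ refl = subst (_∈ₗ basis T ts)
                        (⊆-antisym (λ x → p″ (p′ x)) (λ x → p x)) (premises∈basis {ts} t∈)
    ... | inj₂ refl = subst (_∈ₗ basis T ts)
                        (⊆-antisym (λ x → c x) (λ x → c′ (c″ x))) (conclusions∈basis {ts} t∈)

    -- All standards below `s` are dropped. Each of them follows from `t`, which survives because it
    -- is not below `s`.
    shorten : ∀ {ss} → Represents T ss ⊨ → ∀ {s t} →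
              s ∈ₗ toList ss → t ∈ₗ toList ss → s ≼ t → ¬ t ≼ s →
              ∃[ ts ] Represents T ts ⊨ × length ts < length ss
    shorten {ss} rs {s} {t} s∈ t∈ s≼t t⋠s = go (filter keep? (toList ss)) refl
      where
      keep? : ∀ u → Dec (¬ u ≼ s)
      keep? u = ¬? (u ≼? s)

      t∈kept : t ∈ₗ filter keep? (toList ss)
      t∈kept = ∈-filter⁺ keep? t∈ t⋠s

      extend : ∀ {γ δ} → All (λ u → Mixed T u γ δ) (filter keep? (toList ss)) →
               ∀ {u} → u ∈ₗ toList ss → Mixed T u γ δ
      extend all {u} u∈ with u ≼? s
      ... | yes u≼s = Mixed-≼ {u} {t} (≼-trans {u} {s} {t} u≼s s≼t) (All.lookup all t∈kept)
      ... | no  u⋠s = All.lookup all (∈-filter⁺ keep? u∈ u⋠s)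

      -- Matching on the filtered list through an equation exposes its head, as `List⁺` requires;
      -- the surviving `t` excludes the empty case.
      go : ∀ us → us ≡ filter keep? (toList ss) →
           ∃[ ts ] Represents T ts ⊨ × length ts < length ss
      go [] eq with () ← subst (t ∈ₗ_) (sym eq) t∈kept
      go (u ∷ us) eq = (u ∷ us)
        , (λ γ δ → mk⇔
            (λ m → subst (All _) (sym eq)
               (All.filter⁺ keep? (to (rs γ δ) m)))
            (λ all → from (rs γ δ) (All.tabulate (extend (subst (All _) eq all)))))
        , subst (λ vs → List.length vs < length ss) (sym eq)
            (filter-notAll keep? (toList ss) (lose s∈ (λ s⋠s → s⋠s (≼-refl {s}))))

    minimal⇒maximal : ∀ {ss} → MinimalRepresentation T ss ⊨ → Maximal ss
    minimal⇒maximal {ss} (rs , min) {s} {t} s∈ t∈ s≼t = decidable-stable (t ≼? s) λ t⋠s →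
      let ts , rt , ts<ss = shorten {ss} rs s∈ t∈ s≼t t⋠s in <⇒≱ ts<ss (min ts rt)

    -- Maximality is a decidable condition on pairs of entries, so it can be tested at each stage of
    -- a descent on length by `shorten`.
    maximalRepresentation : ∀ {ss} → Represents T ss ⊨ → ∃[ ts ] Represents T ts ⊨ × Maximal ts
    maximalRepresentation {ss} rs = go ss rs (<-wellFounded _)
      where
      go : ∀ ss → Represents T ss ⊨ → Acc _<_ (length ss) →
           ∃[ ts ] Represents T ts ⊨ × Maximal ts
      go ss rs (acc rec)
        with Any.any? (λ s → Any.any? (λ t → (s ≼? t) ×-dec ¬? (t ≼? s)) (toList ss)) (toList ss)
      ... | no ∄ = ss , rs , λ {s} {t} s∈ t∈ s≼t → decidable-stable (t ≼? s)
                     λ t⋠s → ∄ (lose s∈ (lose t∈ (s≼t , t⋠s)))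
      ... | yes ∃s with find ∃s
      ... | s , s∈ , ∃t with find ∃t
      ... | t , t∈ , s≼t , t⋠s with shorten {ss} rs s∈ t∈ s≼t t⋠s
      ... | ts , rt , ts<ss = go ts rt (rec ts<ss)

    -- If none is minimal, induction on length refutes every representation: with all shorter ones
    -- refuted, the one at hand would be minimal.
    ¬¬minimalRepresentation : ∀ {ss} → Represents T ss ⊨ →
                              ¬ ¬ (∃[ ts ] MinimalRepresentation T ts ⊨)
    ¬¬minimalRepresentation {ss} rs ∄min = go ss rs (<-wellFounded _)
      where
      go : ∀ ss → Represents T ss ⊨ → ¬ Acc _<_ (length ss)
      go ss rs (acc rec) = ∄min (ss , rs , λ ts rt →
        decidable-stable (length ss ≤? length ts) λ ss≰ts → go ts rt (rec (≰⇒> ss≰ts)))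

-- Constants survive the enrichment of the language.

module _ {V : Set} (S : Semantics V) (f : V → V → V) where
  private
    module S  = Semantics S
    module S⁺ = Semantics (enrich S f)

  embed  : S.Formula → S⁺.Formula
  embeds : ∀ {k} → Vec S.Formula k → Vec S⁺.Formula k
  embed (Semantics.atom a)   = Semantics.atom a
  embed (Semantics.app c As) = Semantics.app (just c) (embeds As)
  embeds []       = []
  embeds (A ∷ As) = embed A ∷ embeds As

  eval-embed   : ∀ v A → S⁺.eval v (embed A) ≡ S.eval v A
  evals-embeds : ∀ {k} v (As : Vec S.Formula k) → S⁺.evals v (embeds As) ≡ S.evals v As
  eval-embed v (Semantics.atom a)   = refl
  eval-embed v (Semantics.app c As) = cong S.⟦ c ⟧ (evals-embeds v As)
  evals-embeds v []       = refl
  evals-embeds v (A ∷ As) = cong₂ _∷_ (eval-embed v A) (evals-embeds v As)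

  enrich-constantExpressive : S.ConstantExpressive → S⁺.ConstantExpressive
  enrich-constantExpressive ce x with ce x
  ... | A , A≡x = embed A , λ v val → trans (eval-embed v A) (A≡x v val)

-- Sets of formulas whose image is the same under all valuations.

module _ {V : Set} (S : Semantics V) where
  open Semantics S

  Denotes : Pred Formula 0ℓ → Pred V 0ℓ → Set
  Denotes Γ γ = ∀ v → Valuation v → image v Γ ≐ γ

  denotes-∪ : ∀ {Γ Δ γ δ} → Denotes Γ γ → Denotes Δ δ → Denotes (Γ ∪ Δ) (γ ∪ δ)
  denotes-∪ Γγ Δδ v val =
    (λ where (A , inj₁ A∈ , e) → inj₁ (proj₁ (Γγ v val) (A , A∈ , e))
             (A , inj₂ A∈ , e) → inj₂ (proj₁ (Δδ v val) (A , A∈ , e))) ,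
    (λ where (inj₁ x∈) → let A , A∈ , e = proj₂ (Γγ v val) x∈ in A , inj₁ A∈ , e
             (inj₂ x∈) → let A , A∈ , e = proj₂ (Δδ v val) x∈ in A , inj₂ A∈ , e)

  denotes-｛｝ : ∀ {A x} → (∀ v → Valuation v → eval v A ≡ x) → Denotes ｛ A ｝ ｛ x ｝
  denotes-｛｝ {A} A≡x v val =
    (λ where (_ , refl , e) → trans (sym (A≡x v val)) e) ,
    (λ where refl → A , refl , A≡x v val)

  constants : ConstantExpressive → Pred V 0ℓ → Pred Formula 0ℓ
  constants ce γ A = ∃[ x ] γ x × A ≡ proj₁ (ce x)

  denotes-constants : ∀ ce γ → Denotes (constants ce γ) γ
  denotes-constants ce γ v val =
    (λ where (_ , (x , x∈ , refl) , e) → subst γ (trans (sym (proj₂ (ce x) v val)) e) x∈) ,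
    (λ {x} x∈ → proj₁ (ce x) , (x , x∈ , refl) , proj₂ (ce x) v val)

  -- Realizing the empty assignment yields a valuation, without which `Consequence` would hold
  -- vacuously.
  someValuation : ∃ Valuation
  someValuation with realized {0} (λ ()) (λ {x} → ⊥-elim (Fin.¬Fin0 x)) (λ ())
  ... | v , val , _ = v , val

-- G-disjunctions and compatible lists.

module Disjunction (T : TruthValues) {⊨ : TruthRelation T} where
  open TruthValues T
  open Representations T

  module _ (S : Semantics V) (f : V → V → V) where
    open Semantics (enrich S f)

    _∨_ : Formula → Formula → Formula
    A ∨ B = app nothing (A ∷ B ∷ [])

    compatible⇒gDisjunction : ∀ {ss} → Represents T ss ⊨ →
      (∀ x y → All (λ D → f x y ∈ D ⇔ (x ∈ D ⊎ y ∈ D)) (basis T ss)) →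
      GDisjunction S f ⊨
    compatible⇒gDisjunction {ss} rs f-or Γ Δ A B =
      mk⇔ (lift right⇒) (lift right⇐) ,
      mk⇔ (λ h → lift (left⇒ inj₁) h , lift (left⇒ inj₂) h) left⇐
      where
      _⊢_ : Rel (Pred Formula 0ℓ) 0ℓ
      _⊢_ = Consequence ⊨

      lift : ∀ {Γ Δ Γ′ Δ′} →
        (∀ v {s} → s ∈ₗ toList ss →
          Mixed T s (image v Γ) (image v Δ) → Mixed T s (image v Γ′) (image v Δ′)) →
        Γ ⊢ Δ → Γ′ ⊢ Δ′
      lift g h v val = from (rs _ _) (All.tabulate λ s∈ →
        g v s∈ (All.lookup (to (rs _ _) (h v val)) s∈))

      ∨-premise : ∀ v {s} → s ∈ₗ toList ss → eval v (A ∨ B) ∈ premises s ⇔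
                  (eval v A ∈ premises s ⊎ eval v B ∈ premises s)
      ∨-premise v s∈ = All.lookup (f-or _ _) (premises∈basis {ss} s∈)

      ∨-conclusion : ∀ v {s} → s ∈ₗ toList ss → eval v (A ∨ B) ∈ conclusions s ⇔
                     (eval v A ∈ conclusions s ⊎ eval v B ∈ conclusions s)
      ∨-conclusion v s∈ = All.lookup (f-or _ _) (conclusions∈basis {ss} s∈)

      right⇒ : ∀ v {s} → s ∈ₗ toList ss →
        Mixed T s (image v Γ) (image v (｛ A ∨ B ｝ ∪ Δ)) →
        Mixed T s (image v Γ) (image v ((｛ A ｝ ∪ ｛ B ｝) ∪ Δ))
      right⇒ v s∈ m Γ⊆ with m Γ⊆
      ... | w , (C , inj₂ C∈ , e) , w∈ = w , (C , inj₂ C∈ , e) , w∈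
      ... | _ , (_ , inj₁ refl , refl) , w∈ with to (∨-conclusion v s∈) w∈
      ... | inj₁ a∈ = _ , (A , inj₁ (inj₁ refl) , refl) , a∈
      ... | inj₂ b∈ = _ , (B , inj₁ (inj₂ refl) , refl) , b∈

      right⇐ : ∀ v {s} → s ∈ₗ toList ss →
        Mixed T s (image v Γ) (image v ((｛ A ｝ ∪ ｛ B ｝) ∪ Δ)) →
        Mixed T s (image v Γ) (image v (｛ A ∨ B ｝ ∪ Δ))
      right⇐ v s∈ m Γ⊆ with m Γ⊆
      ... | w , (C , inj₂ C∈ , e) , w∈ = w , (C , inj₂ C∈ , e) , w∈
      ... | _ , (_ , inj₁ (inj₁ refl) , refl) , a∈ =
        _ , (A ∨ B , inj₁ refl , refl) , from (∨-conclusion v s∈) (inj₁ a∈)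
      ... | _ , (_ , inj₁ (inj₂ refl) , refl) , b∈ =
        _ , (A ∨ B , inj₁ refl , refl) , from (∨-conclusion v s∈) (inj₂ b∈)

      -- Serves both directions of the left rule: `A ∨ B` is `D` in `left⇒` and `C` in `left⇐`.
      replace : ∀ {C D} v {s} →
        (eval v C ∈ premises s → eval v D ∈ premises s) →
        Mixed T s (image v (Γ ∪ ｛ D ｝)) (image v Δ) →
        Mixed T s (image v (Γ ∪ ｛ C ｝)) (image v Δ)
      replace {C} v C⇒D m ΓC⊆ = m λ where
        (E , inj₁ E∈ , e)      → ΓC⊆ (E , inj₁ E∈ , e)
        (_ , inj₂ refl , refl) → C⇒D (ΓC⊆ (C , inj₂ refl , refl))

      left⇒ : ∀ {C} → (∀ {v s} → eval v C ∈ premises s →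
                eval v A ∈ premises s ⊎ eval v B ∈ premises s) →
        ∀ v {s} → s ∈ₗ toList ss →
        Mixed T s (image v (Γ ∪ ｛ A ∨ B ｝)) (image v Δ) →
        Mixed T s (image v (Γ ∪ ｛ C ｝)) (image v Δ)
      left⇒ C⇒ v {s} s∈ = replace v {s} (λ c∈ → from (∨-premise v s∈) (C⇒ {v} {s} c∈))

      left⇐ : (Γ ∪ ｛ A ｝) ⊢ Δ × (Γ ∪ ｛ B ｝) ⊢ Δ → (Γ ∪ ｛ A ∨ B ｝) ⊢ Δ
      -- Which hypothesis applies depends on the valuation and the standard: it is that of a
      -- disjunct whose value is designated there.
      left⇐ (hA , hB) v val = from (rs _ _) (All.tabulate λ {s} s∈ Γ∨⊆ →
        [ (λ a∈ → replace v {s} (λ _ → a∈) (All.lookup (to (rs _ _) (hA v val)) s∈) Γ∨⊆)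
        , (λ b∈ → replace v {s} (λ _ → b∈) (All.lookup (to (rs _ _) (hB v val)) s∈) Γ∨⊆)
        ]′ (to (∨-premise v s∈) (Γ∨⊆ (A ∨ B , inj₂ refl , refl))))

  module _ (S : Semantics V) {ss} (rs : Represents T ss ⊨) where
    open Semantics S

    -- With constant denotations the sequent says the same at every valuation, so a single one
    -- suffices to read off `⊨`.
    ⊢⇔⊨ : ∀ {Γ Δ γ δ} → Denotes S Γ γ → Denotes S Δ δ → Consequence ⊨ Γ Δ ⇔ ⊨ γ δ
    ⊢⇔⊨ Γγ Δδ = mk⇔
      (λ h → let v , val = someValuation S in ⊨-≐ rs (Γγ v val) (Δδ v val) (h v val))
      (λ m v val → let Γ⊆ , Γ⊇ = Γγ v val ; Δ⊆ , Δ⊇ = Δδ v val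
                   in ⊨-≐ rs (Γ⊇ , Γ⊆) (Δ⊇ , Δ⊆) m)

  record TruthRules (f : V → V → V) : Set₁ where
    field
      right : ∀ γ δ x y → ⊨ γ (｛ f x y ｝ ∪ δ) ⇔ ⊨ γ ((｛ x ｝ ∪ ｛ y ｝) ∪ δ)
      left  : ∀ γ δ x y → ⊨ (γ ∪ ｛ f x y ｝) δ ⇔ (⊨ (γ ∪ ｛ x ｝) δ × ⊨ (γ ∪ ｛ y ｝) δ)

  gDisjunction⇒truthRules : ∀ {ss} → Represents T ss ⊨ →
    (S : Semantics V) → Semantics.ConstantExpressive S →
    ∀ {f} → GDisjunction S f ⊨ → TruthRules f
  gDisjunction⇒truthRules {ss} rs S ce {f} g = record
    { right = λ γ δ x y →
        let f⊨  = ⊢⇔⊨′ (set γ) (denotes-∪ S⁺ (value∨ x y) (set δ))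
            xy⊨ = ⊢⇔⊨′ (set γ) (denotes-∪ S⁺ (denotes-∪ S⁺ (value x) (value y)) (set δ))
        in ⇔-trans (⇔-sym f⊨) (⇔-trans (proj₁ (g (K γ) (K δ) (c x) (c y))) xy⊨)
    ; left = λ γ δ x y →
        let rules = proj₂ (g (K γ) (K δ) (c x) (c y))
            f⊨ = ⊢⇔⊨′ (denotes-∪ S⁺ (set γ) (value∨ x y)) (set δ)
            x⊨ = ⊢⇔⊨′ (denotes-∪ S⁺ (set γ) (value x)) (set δ)
            y⊨ = ⊢⇔⊨′ (denotes-∪ S⁺ (set γ) (value y)) (set δ)
        in mk⇔ (λ m → let hx , hy = to rules (from f⊨ m) in to x⊨ hx , to y⊨ hy)
               (λ (mx , my) → to f⊨ (from rules (from x⊨ mx , from y⊨ my)))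
    }
    where
    S⁺ : Semantics V
    S⁺ = enrich S f

    open Semantics S⁺ using (Formula; Consequence; ConstantExpressive)

    ce⁺ : ConstantExpressive
    ce⁺ = enrich-constantExpressive S f ce

    c : V → Formula
    c x = proj₁ (ce⁺ x)

    K : Pred V 0ℓ → Pred Formula 0ℓ
    K = constants S⁺ ce⁺

    set : ∀ γ → Denotes S⁺ (K γ) γ
    set = denotes-constants S⁺ ce⁺

    value : ∀ x → Denotes S⁺ ｛ c x ｝ ｛ x ｝
    value x = denotes-｛｝ S⁺ (proj₂ (ce⁺ x))

    value∨ : ∀ x y → Denotes S⁺ ｛ _∨_ S f (c x) (c y) ｝ ｛ f x y ｝
    value∨ x y = denotes-｛｝ S⁺ λ v val → cong₂ f (proj₂ (ce⁺ x) v val) (proj₂ (ce⁺ y) v val)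

    ⊢⇔⊨′ : ∀ {Γ Δ γ δ} → Denotes S⁺ Γ γ → Denotes S⁺ Δ δ → Consequence ⊨ Γ Δ ⇔ ⊨ γ δ
    ⊢⇔⊨′ = ⊢⇔⊨ S⁺ {ss} rs

  -- For s in a maximal representation, ⊨ agrees with s on γ ⊇ P s and δ ⊇ ∁ C s:
  -- enlarging γ or δ from these tests membership in P s, respectively C s.
  truthRules⇒compatible : ∀ {ss} → Represents T ss ⊨ → Maximal ss →
    ∀ {f} → TruthRules f → DisjunctionCompatible T (basis T ss)
  truthRules⇒compatible {ss} rs max {f} rules x y = f x y , All.tabulate compat
    where
    open TruthRules rules

    module _ {s} (s∈ : s ∈ₗ toList ss) where
      P ∁C : Pred V 0ℓ
      P  = _∈ premises s
      ∁C = _∉ conclusions s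

      mixed⇔⊨ : ∀ {γ δ} → P ⊆ᵤ γ → ∁C ⊆ᵤ δ → Mixed T s γ δ ⇔ ⊨ γ δ
      mixed⇔⊨ P⊆ ∁C⊆ = ⇔-trans (maximal-mixed {ss} max s∈ P⊆ ∁C⊆) (⇔-sym (rs _ _))

      -- All premises are designated and nothing in `∁C` is, so only `η` can supply the conclusion
      -- that `s` demands.
      conclusion⇔ : ∀ {η} → ⊨ P (η ∪ ∁C) ⇔ ∃ λ w → η w × w ∈ conclusions s
      conclusion⇔ {η} = mk⇔ only-η (λ (w , w∈η , w∈C) → to m⇔ λ _ → w , inj₁ w∈η , w∈C)
        where
        m⇔ : Mixed T s P (η ∪ ∁C) ⇔ ⊨ P (η ∪ ∁C)
        m⇔ = mixed⇔⊨ id inj₂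

        only-η : ⊨ P (η ∪ ∁C) → ∃ λ w → η w × w ∈ conclusions s
        only-η m with from m⇔ m id
        ... | w , inj₁ w∈η , w∈C = w , w∈η , w∈C
        ... | w , inj₂ w∉C , w∈C = contradiction w∈C w∉C

      -- No conclusion in `∁C` is designated, so `s` can hold only by a failing premise, and `w` is
      -- the only candidate.
      premise⇔ : ∀ {w} → ⊨ (P ∪ ｛ w ｝) ∁C ⇔ w ∉ premises s
      premise⇔ {w} = mk⇔ rejects (λ w∉P → to m⇔ λ ⊆P → contradiction (⊆P (inj₂ refl)) w∉P)
        where
        m⇔ : Mixed T s (P ∪ ｛ w ｝) ∁C ⇔ ⊨ (P ∪ ｛ w ｝) ∁C
        m⇔ = mixed⇔⊨ inj₁ id

        rejects : ⊨ (P ∪ ｛ w ｝) ∁C → w ∉ premises s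
        rejects m w∈P with from m⇔ m (λ where (inj₁ u∈P) → u∈P ; (inj₂ refl) → w∈P)
        ... | _ , u∉C , u∈C = u∉C u∈C

      conclusions-or : f x y ∈ conclusions s ⇔ (x ∈ conclusions s ⊎ y ∈ conclusions s)
      conclusions-or = mk⇔ split join
        where
        split : f x y ∈ conclusions s → x ∈ conclusions s ⊎ y ∈ conclusions s
        split z∈ with to conclusion⇔ (to (right P ∁C x y) (from conclusion⇔ (_ , refl , z∈)))
        ... | _ , inj₁ refl , x∈ = inj₁ x∈
        ... | _ , inj₂ refl , y∈ = inj₂ y∈

        join′ : (∃ λ w → (｛ x ｝ ∪ ｛ y ｝) w × w ∈ conclusions s) → f x y ∈ conclusions s
        join′ w∈ with to conclusion⇔ (from (right P ∁C x y) (from conclusion⇔ w∈))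
        ... | _ , refl , z∈ = z∈

        join : x ∈ conclusions s ⊎ y ∈ conclusions s → f x y ∈ conclusions s
        join = [ (λ x∈ → join′ (x , inj₁ refl , x∈)) , (λ y∈ → join′ (y , inj₂ refl , y∈)) ]′

      premises-or : f x y ∈ premises s ⇔ (x ∈ premises s ⊎ y ∈ premises s)
      premises-or = mk⇔ split join
        where
        split : f x y ∈ premises s → x ∈ premises s ⊎ y ∈ premises s
        -- `premise⇔` only speaks of non-membership; decidability of the sets turns the
        -- contrapositive into the claim.
        split z∈ = decidable-stable ((x ∈? premises s) ⊎-dec (y ∈? premises s)) λ neither →
          to premise⇔ (from (left P ∁C x y)
            (from premise⇔ (neither ∘ inj₁) , from premise⇔ (neither ∘ inj₂))) z∈

        join : x ∈ premises s ⊎ y ∈ premises s → f x y ∈ premises s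
        join x⊎y = decidable-stable (f x y ∈? premises s) λ z∉ →
          let mx , my = to (left P ∁C x y) (from premise⇔ z∉)
          in [ to premise⇔ mx , to premise⇔ my ]′ x⊎y

    compat : ∀ {D} → D ∈ₗ basis T ss → f x y ∈ D ⇔ (x ∈ D ⊎ y ∈ D)
    compat D∈ with ∈-basis⁻ {ss} D∈
    ... | s , s∈ , inj₁ refl = premises-or s∈
    ... | s , s∈ , inj₂ refl = conclusions-or s∈

theorem7p2 : (T : TruthValues) (⊨ : TruthRelation T) → IntersectiveMixed T ⊨ →
    (S : Semantics (TruthValues.V T)) → Semantics.ConstantExpressive S →
    (AdmitsGDisjunction S ⊨ ⇔
    (∀ ss → MinimalRepresentation T ss ⊨ → DisjunctionCompatible T (basis T ss))) ×
    ((∀ ss → MinimalRepresentation T ss ⊨ → DisjunctionCompatible T (basis T ss)) ⇔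
    (∃[ ss ] Represents T ss ⊨ × DisjunctionCompatible T (basis T ss)))
theorem7p2 T ⊨ (ss , rs) S ce = mk⇔ i⇒ii (iii⇒i ∘ ii⇒iii) , mk⇔ ii⇒iii iii⇒ii
  where
  open Representations T
  open Disjunction T

  I II III : Set₁
  I   = AdmitsGDisjunction S ⊨
  II  = ∀ ss → MinimalRepresentation T ss ⊨ → DisjunctionCompatible T (basis T ss)
  III = ∃[ ss ] Represents T ss ⊨ × DisjunctionCompatible T (basis T ss)

  i⇒ii : I → II
  i⇒ii (f , g) ts min = truthRules⇒compatible {ss = ts} (proj₁ min) (minimal⇒maximal {ss = ts} min)
    (gDisjunction⇒truthRules {ss = ss} rs S ce g)

  iii⇒i : III → I
  iii⇒i (ts , rt , compat) = (λ x y → proj₁ (compat x y)) ,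
    compatible⇒gDisjunction S _ {ts} rt (λ x y → proj₂ (compat x y))

  iii⇒ii : III → II
  -- A minimal representation uses only sets occurring in the compatible one, and compatibility
  -- passes to sublists.
  iii⇒ii (ts , rt , compat) us min = compatible-⊆
    (basis-maximal-⊆ {ss = us} {ts} (minimal⇒maximal {ss = us} min) (proj₁ min) rt) compat

  -- Compatibility is decidable, so it suffices that a minimal representation
  -- cannot fail to exist.
  ii⇒iii : II → III
  ii⇒iii allMin with maximalRepresentation {ss = ss} rs
  ... | ts , rt , max = ts , rt , decidable-stable (compatible? (basis T ts)) λ incompat →
    ¬¬minimalRepresentation {ss = ss} rs λ (us , min) →
      incompat (compatible-⊆ (basis-maximal-⊆ {ss = ts} {us} max rt (proj₁ min)) (allMin us min))
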